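{- Let $n\ge 6$ be an integer. Then $$sat(n,K_{3,3})\le \begin{cases} 2n, & 6\le n\le 8,\\ 3n-9, & n\ge 9.\end{cases}$$
   Context: All graphs are finite and simple. $K_{3,3}$ is the complete bipartite graph with both parts of size $3$, and $\overline{G}$ is the complement of $G$. A graph $G$ is $F$-saturated if $G$ does not contain $F$ as a (not necessarily induced) subgraph, but for every edge $e\in E(\overline{G})$ the graph $G+e$ contains $F$ as a subgraph. The saturation number $sat(n,F)$ is the minimum number of edges in an $n$-vertex $F$-saturated graph. -}

module Defs where

open import Data.Bool using (Bool; false; T; not; _∧_; _∨_; _xor_)
open import Data.Bool.Properties
  using (T?; ∧-comm; ∨-comm; xor-comm; xor-same)
open import Data.Empty using (⊥-elim)
open import Data.Fin using (Fin; toℕ; _<?_)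
open import Data.Fin.Properties using (_≟_)
open import Data.List using (List; length; filter; allFin; cartesianProduct)
open import Data.Nat using (ℕ; _+_; _≤_; _<ᵇ_)
open import Data.Product using (Σ; _×_; _,_)
open import Function.Definitions using (Injective)
open import Relation.Binary.PropositionalEquality
  using (_≡_; _≢_; refl; sym; trans; cong; cong₂; subst)
open import Relation.Nullary using (¬_; yes; no; does)
open import Relation.Nullary.Decidable using (_×-dec_; dec-false)

record Graph (n : ℕ) : Set where
  field
    adj        : Fin n → Fin n → Bool
    adj-sym    : ∀ i j → adj i j ≡ adj j i
    adj-irrefl : ∀ i → adj i i ≡ false

  Edge : Fin n → Fin n → Set
  Edge i j = T (adj i j)

  Edge⇒≢ : ∀ {i j} → Edge i j → i ≢ j
  Edge⇒≢ {i} e refl = subst T (adj-irrefl i) e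

  -- Each unordered edge {i , j} is listed once, as the pair with i < j.
  edges : List (Fin n × Fin n)
  edges = filter (λ (i , j) → (i <? j) ×-dec T? (adj i j))
                 (cartesianProduct (allFin n) (allFin n))

  size : ℕ
  size = length edges

open Graph public

private
  ≟-sym : ∀ {n} (i j : Fin n) → does (i ≟ j) ≡ does (j ≟ i)
  ≟-sym i j with i ≟ j
  ... | no i≢j = sym (dec-false (j ≟ i) (λ j≡i → i≢j (sym j≡i)))
  ... | yes refl with i ≟ i
  ...   | yes _  = refl
  ...   | no i≢i = ⊥-elim (i≢i refl)

complement : ∀ {n} → Graph n → Graph n
complement G .adj i j = not (does (i ≟ j)) ∧ not (adj G i j)
complement G .adj-sym i j =
  cong₂ _∧_ (cong not (≟-sym i j)) (cong not (adj-sym G i j))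
complement G .adj-irrefl i with i ≟ i
... | yes _  = refl
... | no i≢i = ⊥-elim (i≢i refl)

addEdge : ∀ {n} (G : Graph n) (u v : Fin n) → u ≢ v → Graph n
addEdge G u v u≢v .adj i j =
  adj G i j ∨ ((does (i ≟ u) ∧ does (j ≟ v)) ∨ (does (i ≟ v) ∧ does (j ≟ u)))
addEdge G u v u≢v .adj-sym i j =
  cong₂ _∨_ (adj-sym G i j)
    (trans (∨-comm (does (i ≟ u) ∧ does (j ≟ v)) _)
      (cong₂ _∨_ (∧-comm (does (i ≟ v)) _) (∧-comm (does (i ≟ u)) _)))
addEdge G u v u≢v .adj-irrefl i rewrite adj-irrefl G i with i ≟ u | i ≟ v
... | yes refl | yes refl = ⊥-elim (u≢v refl)
... | yes _    | no _     = refl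
... | no _     | yes _    = refl
... | no _     | no _     = refl

-- The parts are the first a and the last b vertices.
completeBipartite : (a b : ℕ) → Graph (a + b)
completeBipartite a b .adj i j = (toℕ i <ᵇ a) xor (toℕ j <ᵇ a)
completeBipartite a b .adj-sym i j = xor-comm (toℕ i <ᵇ a) (toℕ j <ᵇ a)
completeBipartite a b .adj-irrefl i = xor-same (toℕ i <ᵇ a)

-- Subgraph containment up to isomorphism; non-edges of F may map to edges of G.
_⊑_ : ∀ {k n} → Graph k → Graph n → Set
_⊑_ {k} {n} F G =
  Σ (Fin k → Fin n) λ f →
    Injective _≡_ _≡_ f × (∀ i j → Edge F i j → Edge G (f i) (f j))

Saturated : ∀ {k n} → Graph k → Graph n → Set
Saturated F G =
  ¬ (F ⊑ G) ×
  (∀ u v (e : Edge (complement G) u v) →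
     F ⊑ addEdge G u v (Edge⇒≢ (complement G) e))

-- sat(n , F) = s.  The minimum is a relation because for some F (for example
-- an edgeless F on at most n vertices) no n-vertex F-saturated graph exists.
IsSaturationNumber : ∀ {k} (n : ℕ) → Graph k → ℕ → Set
IsSaturationNumber n F s =
  (Σ (Graph n) λ G → Saturated F G × size G ≡ s) ×
  (∀ (G : Graph n) → Saturated F G → s ≤ size G)

{-# OPTIONS --safe #-}
-- Let x and y be vertices of a K₃₃-saturated graph such that every other vertex is
-- adjacent to both of them or to two of their common neighbours.  Adding a disjoint
-- triangle and joining it to x and y keeps this property: a K₃₃ using a new vertex
-- would live on the five vertices x, y and the triangle, while each new non-edge ts
-- completes a K₃₃, built either on x, y and the rest of the triangle or on x, y and
-- the two common neighbours.  This costs nine edges for three vertices, so suitable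
-- graphs of orders 9, 10 and 11 with 3n − 9 edges settle all n ≥ 9.
--
-- The minimum defining sat exists constructively because saturation is decidable and
-- there are finitely many adjacency matrices up to pointwise equality.
module Submission where

open import Data.Bool using (Bool; true; false; T; not; _∧_; _∨_)
open import Data.Bool.Properties using (T?; T-∨; T-∧)
import Data.Bool.Properties as Bool
open import Data.Empty using (⊥-elim)
open import Data.Fin using (Fin; toℕ; zero; suc; _↑ˡ_; _↑ʳ_; splitAt; join; punchIn; _<?_)
open import Data.Fin.Patterns using (0F; 1F; 2F)
open import Data.Fin.Properties
  using (_≟_; all?; any?; injective⇒≤; join-splitAt; splitAt-↑ˡ; ↑ˡ-injective; ↑ʳ-injective;
         punchInᵢ≢i; punchIn-injective)
open import Data.List using (List; []; _∷_; _++_; length; map; lookup; allFin; cartesianProduct)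
open import Data.List.Membership.Propositional using (_∈_)
open import Data.List.Membership.Propositional.Properties
  using (∈-lookup; ∈-map⁺; ∈-++⁺ˡ; ∈-++⁺ʳ; ∈-cartesianProduct⁺; ∈-allFin; ∈-filter⁺; ∈-filter⁻)
open import Data.List.Properties using (filter-≐; length-map)
import Data.List.Relation.Unary.All as All
open import Data.List.Relation.Unary.AllPairs using (_∷_)
open import Data.List.Relation.Unary.Any using (here; there; index)
open import Data.List.Relation.Unary.Any.Properties using (lookup-index)
open import Data.List.Relation.Unary.Unique.Propositional using (Unique)
open import Data.List.Relation.Unary.Unique.Propositional.Properties
  using (filter⁺; cartesianProduct⁺; allFin⁺)
open import Data.Nat using (ℕ; zero; suc; _+_; _*_; _∸_; _≤_; _<_; s≤s)
open import Data.Nat.Induction using (<-wellFounded)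
import Data.Nat.Properties as ℕ
open import Data.List.Membership.DecPropositional ℕ._≟_ using (_∈?_)
open import Data.Product using (Σ; ∃; ∃-syntax; _×_; _,_; proj₁; proj₂)
open import Data.Sum using (_⊎_; inj₁; inj₂; [_,_]′)
open import Data.Vec using (Vec; []; _∷_)
import Data.Vec as Vec
open import Data.Vec.Functional using (Vector; head; tail) renaming ([] to []ᶠ; _∷_ to _∷ᶠ_)
open import Data.Vec.Functional.Relation.Binary.Pointwise using (Pointwise)
open import Function using (_∘_; id)
open import Function.Bundles using (module Equivalence; mk⇔)
open import Function.Definitions using (Injective)
open import Induction.WellFounded using (Acc; acc)
open import Relation.Binary.Definitions using (Reflexive; _Respects_)
open import Relation.Binary.PropositionalEquality
  using (_≡_; _≢_; refl; sym; trans; cong; subst; subst₂)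
open import Relation.Nullary using (¬_; Dec; yes; no; does; contradiction)
open import Relation.Nullary.Decidable
  using (_×-dec_; _⊎-dec_; _→-dec_; ¬?; map′; from-yes; dec-true; dec-false; does-⇔;
         True; toWitness)
open import Relation.Unary using (Decidable)
open import Defs

private
  variable
    k n : ℕ

-- Decidability of saturation and existence of the saturation number.

-- Functions on a finite set can be enumerated only up to pointwise equality, so the predicates
-- searched are those respecting a chosen relation on `A`.
Searchable : (A : Set) → (A → A → Set) → Set₁
Searchable A _≈_ =
  ∀ {P : A → Set} → P Respects _≈_ → Decidable P → Dec (∃ P)

Fin-searchable : Searchable (Fin n) _≡_
Fin-searchable _ P? = any? P?

Bool-searchable : Searchable Bool _≡_
Bool-searchable _ P? with P? false | P? true
... | yes p | _     = yes (false , p)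
... | no _  | yes p = yes (true , p)
... | no ¬f | no ¬t = no λ { (false , p) → ¬f p ; (true , p) → ¬t p }

-- Search for the head and, for each candidate, for the tail. A vector is only pointwise equal to
-- its head consed onto its tail, which is where `P-resp` enters.
Vector-searchable : ∀ {A : Set} {_≈_ : A → A → Set} → Reflexive _≈_ →
  Searchable A _≈_ → ∀ n → Searchable (Vector A n) (Pointwise _≈_)
Vector-searchable ≈-refl A-search zero P-resp P? =
  map′ ([]ᶠ ,_) (λ (_ , p) → P-resp (λ ()) p) (P? []ᶠ)
Vector-searchable ≈-refl A-search (suc n) P-resp P? =
  map′ (λ (a , f , p) → (a ∷ᶠ f) , p)
       (λ (f , p) → head f , tail f ,
          P-resp (λ { zero → ≈-refl ; (suc _) → ≈-refl }) p)
       (A-search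
         (λ a≈b (f , p) → f , P-resp (λ { zero → a≈b ; (suc _) → ≈-refl }) p)
         (λ a → Vector-searchable ≈-refl A-search n
           (λ f≈g → P-resp (λ { zero → ≈-refl ; (suc i) → f≈g i }))
           (λ f → P? (a ∷ᶠ f))))

Matrix : ℕ → Set
Matrix n = Fin n → Fin n → Bool

_≈ᴹ_ : Matrix n → Matrix n → Set
A ≈ᴹ B = ∀ i j → A i j ≡ B i j

⊑-resp : ∀ {F : Graph k} {G H : Graph n} → adj G ≈ᴹ adj H → F ⊑ G → F ⊑ H
⊑-resp G≈H (f , inj , hom) =
  f , inj , λ i j e → subst T (G≈H (f i) (f j)) (hom i j e)

Saturated-resp : ∀ {F : Graph k} {G H : Graph n} → adj G ≈ᴹ adj H →
  Saturated F G → Saturated F H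
Saturated-resp {F = F} {G} {H} G≈H (free , sat) =
  (λ F⊑H → free (⊑-resp {F = F} {H} {G} (λ i j → sym (G≈H i j)) F⊑H)) ,
  λ u v e → let e′ = subst (λ b → T (not (does (u ≟ v)) ∧ not b)) (sym (G≈H u v)) e in
    ⊑-resp {F = F} {addEdge G u v (Edge⇒≢ (complement G) e′)}
      {addEdge H u v (Edge⇒≢ (complement H) e)}
      (λ i j → cong (_∨ _) (G≈H i j)) (sat u v e′)

size-resp : ∀ {G H : Graph n} → adj G ≈ᴹ adj H → size G ≡ size H
size-resp {n} G≈H = cong length (filter-≐ _ _
  ( (λ (i<j , e) → i<j , subst T (G≈H _ _) e)
  , (λ (i<j , e) → i<j , subst T (sym (G≈H _ _)) e))
  (cartesianProduct (allFin n) (allFin n)))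

_⊑?_ : (F : Graph k) (G : Graph n) → Dec (F ⊑ G)
_⊑?_ {k} {n} F G =
  Vector-searchable refl Fin-searchable k
    (λ {f} {g} f≗g (inj , hom) →
      (λ {i} {j} eq → inj (trans (f≗g i) (trans eq (sym (f≗g j))))) ,
      λ i j e → subst₂ (Edge G) (f≗g i) (f≗g j) (hom i j e))
    (λ f → injective? f ×-dec
      all? λ i → all? λ j → T? (adj F i j) →-dec T? (adj G (f i) (f j)))
  where
  injective? : (f : Fin k → Fin n) → Dec (Injective _≡_ _≡_ f)
  injective? f = map′ (λ h {i} {j} → h i j) (λ h i j → h {i} {j})
    (all? λ i → all? λ j → (f i ≟ f j) →-dec (i ≟ j))

Saturated? : (F : Graph k) (G : Graph n) → Dec (Saturated F G)
Saturated? F G = ¬? (F ⊑? G) ×-dec all? λ u → all? λ v → creates? u v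
  where
  creates? : ∀ u v → Dec (∀ (e : Edge (complement G) u v) →
    F ⊑ addEdge G u v (Edge⇒≢ (complement G) e))
  creates? u v with T? (adj (complement G) u v)
  ... | no ¬e = yes λ e → ⊥-elim (¬e e)
  -- The adjacency of `addEdge` ignores the proof of distinctness, so an answer for one `e` serves
  -- for every other proof.
  ... | yes e = map′ (λ p _ → p) (λ p → p e)
                  (F ⊑? addEdge G u v (Edge⇒≢ (complement G) e))

-- The search runs over bare matrices. Asking for some graph with pointwise equal adjacency makes
-- the predicate respect that equality by construction.
saturatedOfSize? : (F : Graph k) (n s : ℕ) →
  Dec (∃[ G ] (Saturated {n = n} F G × size G ≡ s))
saturatedOfSize? F n s =
  map′ (λ (_ , G , _ , p) → G , p) (λ (G , p) → adj G , G , (λ _ _ → refl) , p)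
    (Vector-searchable (λ _ → refl) (Vector-searchable refl Bool-searchable n) n
      (λ A≈B (G , G≈A , p) → G , (λ i j → trans (G≈A i j) (A≈B i j)) , p)
      realised?)
  where
  realised? : (A : Matrix n) →
    Dec (∃[ G ] (adj G ≈ᴹ A × Saturated F G × size G ≡ s))
  realised? A with all? (λ i → all? λ j → A i j Bool.≟ A j i)
                 | all? (λ i → A i i Bool.≟ false)
  ... | no ¬sym | _ = no λ (G , G≈A , _) → ¬sym λ i j →
          trans (sym (G≈A i j)) (trans (adj-sym G i j) (G≈A j i))
  ... | yes _ | no ¬irr = no λ (G , G≈A , _) → ¬irr λ i →
          trans (sym (G≈A i i)) (adj-irrefl G i)
  ... | yes A-sym | yes A-irr =
    map′ (λ p → G₀ , (λ _ _ → refl) , p)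
         (λ (G , G≈A , sat , eq) →
           Saturated-resp {F = F} {G} {G₀} G≈A sat ,
           trans (sym (size-resp {G = G} {G₀} G≈A)) eq)
         (Saturated? F G₀ ×-dec (size G₀ ℕ.≟ s))
    where
    G₀ : Graph n
    G₀ = record { adj = A ; adj-sym = A-sym ; adj-irrefl = A-irr }

-- Descend to a smaller witness as long as the bounded search below finds one.
least : ∀ {P : ℕ → Set} → Decidable P → ∀ m → P m →
  ∃[ s ] (P s × s ≤ m × (∀ j → P j → s ≤ j))
least {P} P? m = go m (<-wellFounded m)
  where
  go : ∀ m → Acc _<_ m → P m → ∃[ s ] (P s × s ≤ m × (∀ j → P j → s ≤ j))
  go m (acc rec) p with ℕ.anyUpTo? P? m
  ... | no none = m , p , ℕ.≤-refl ,
        λ j q → ℕ.≮⇒≥ λ j<m → none (j , j<m , q)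
  ... | yes (j , j<m , q) with go j (rec j<m) q
  ...   | s , r , s≤j , min = s , r , ℕ.≤-trans s≤j (ℕ.<⇒≤ j<m) , min

-- A single saturated graph shows that the minimum exists and bounds it from above.
saturationNumber≤ : (F : Graph k) (G : Graph n) → Saturated F G →
  ∃[ s ] (IsSaturationNumber n F s × s ≤ size G)
saturationNumber≤ {n = n} F G sat
  with least (saturatedOfSize? F n) (size G) (G , sat , refl)
... | s , attained , s≤ , min =
  s , (attained , λ H satH → min (size H) (H , satH , refl)) , s≤

-- Copies of K₃₃ and a decidable form of saturation.

K₃₃ : Graph 6
K₃₃ = completeBipartite 3 3

-- The two sides are disjoint because `cross` joins them by edges, whose ends are distinct.
record Biclique (G : Graph n) : Set where
  field
    left right      : Fin 3 → Fin n
    left-injective  : Injective _≡_ _≡_ left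
    right-injective : Injective _≡_ _≡_ right
    cross           : ∀ i j → Edge G (left i) (right j)

open Biclique

swap : {G : Graph n} → Biclique G → Biclique G
swap {G = G} B = record
  { left            = right B
  ; right           = left B
  ; left-injective  = right-injective B
  ; right-injective = left-injective B
  ; cross           = λ i j → subst T (adj-sym G (left B j) (right B i)) (cross B j i)
  }

⊑⇒Biclique : {G : Graph n} → K₃₃ ⊑ G → Biclique G
⊑⇒Biclique (f , inj , hom) = record
  { left            = λ i → f (i ↑ˡ 3)
  ; right           = λ j → f (3 ↑ʳ j)
  ; left-injective  = λ eq → ↑ˡ-injective 3 _ _ (inj eq)
  ; right-injective = λ eq → ↑ʳ-injective 3 _ _ (inj eq)
  ; cross           = λ i j → hom (i ↑ˡ 3) (3 ↑ʳ j) (K-cross i j)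
  }
  where
  K-cross : ∀ i j → Edge K₃₃ (i ↑ˡ 3) (3 ↑ʳ j)
  K-cross = from-yes (all? λ (i : Fin 3) → all? λ j → T? (adj K₃₃ (i ↑ˡ 3) (3 ↑ʳ j)))

module _ {G : Graph n} (B : Biclique G) where

  vertex : Fin 3 ⊎ Fin 3 → Fin n
  vertex = [ left B , right B ]′

  vertex-injective : Injective _≡_ _≡_ vertex
  vertex-injective {inj₁ i} {inj₁ j} eq = cong inj₁ (left-injective B eq)
  vertex-injective {inj₁ i} {inj₂ j} eq = ⊥-elim (Edge⇒≢ G (cross B i j) eq)
  vertex-injective {inj₂ i} {inj₁ j} eq = ⊥-elim (Edge⇒≢ G (cross B j i) (sym eq))
  vertex-injective {inj₂ i} {inj₂ j} eq = cong inj₂ (right-injective B eq)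

  Biclique⇒⊑ : K₃₃ ⊑ G
  Biclique⇒⊑ =
    vertex ∘ splitAt 3 ,
    (λ {i} {j} eq → splitAt-injective i j (vertex-injective eq)) ,
    λ i j → subst₂ (λ i′ j′ → Edge K₃₃ i′ j′ → Edge G (vertex (splitAt 3 i)) (vertex (splitAt 3 j)))
      (join-splitAt 3 3 i) (join-splitAt 3 3 j) (hom (splitAt 3 i) (splitAt 3 j))
    where
    splitAt-injective : ∀ i j → splitAt 3 i ≡ splitAt 3 j → i ≡ j
    splitAt-injective i j eq =
      trans (sym (join-splitAt 3 3 i)) (trans (cong (join 3 3) eq) (join-splitAt 3 3 j))

    independentˡ : ∀ (i j : Fin 3) → ¬ Edge K₃₃ (i ↑ˡ 3) (j ↑ˡ 3)
    independentˡ = from-yes (all? λ (i : Fin 3) → all? λ (j : Fin 3) →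
      ¬? (T? (adj K₃₃ (i ↑ˡ 3) (j ↑ˡ 3))))

    independentʳ : ∀ (i j : Fin 3) → ¬ Edge K₃₃ (3 ↑ʳ i) (3 ↑ʳ j)
    independentʳ = from-yes (all? λ i → all? λ j → ¬? (T? (adj K₃₃ (3 ↑ʳ i) (3 ↑ʳ j))))

    hom : ∀ s t → Edge K₃₃ (join 3 3 s) (join 3 3 t) → Edge G (vertex s) (vertex t)
    hom (inj₁ i) (inj₁ j) e = ⊥-elim (independentˡ i j e)
    hom (inj₁ i) (inj₂ j) _ = cross B i j
    hom (inj₂ i) (inj₁ j) _ = cross (swap {G = G} B) i j
    hom (inj₂ i) (inj₂ j) e = ⊥-elim (independentʳ i j e)

-- All edges but uv of a K₃₃ with parts {u , a , a′} and {v , b , b′}.  The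
-- quantifiers alternate between the parts so that a search can prune early.
Completes : Graph n → Fin n → Fin n → Set
Completes G u v =
  ∃[ a ] u ≢ a × Edge G v a ×
  (∃[ b ] v ≢ b × Edge G u b × Edge G a b ×
  (∃[ a′ ] u ≢ a′ × a ≢ a′ × Edge G v a′ × Edge G a′ b ×
  (∃[ b′ ] v ≢ b′ × b ≢ b′ × Edge G u b′ × Edge G a b′ × Edge G a′ b′)))

completes? : (G : Graph n) → ∀ u v → Dec (Completes G u v)
completes? G u v =
  any? λ a → u ≢? a ×-dec edge? v a ×-dec
  any? λ b → v ≢? b ×-dec edge? u b ×-dec edge? a b ×-dec
  any? λ a′ → u ≢? a′ ×-dec a ≢? a′ ×-dec edge? v a′ ×-dec edge? a′ b ×-dec
  any? λ b′ → v ≢? b′ ×-dec b ≢? b′ ×-dec edge? u b′ ×-dec edge? a b′ ×-dec edge? a′ b′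
  where
  infix 4 _≢?_
  _≢?_ : (i j : Fin _) → Dec (i ≢ j)
  i ≢? j = ¬? (i ≟ j)

  edge? : ∀ i j → Dec (Edge G i j)
  edge? i j = T? (adj G i j)

Edge-sym : (G : Graph n) → ∀ {u v} → Edge G u v → Edge G v u
Edge-sym G = subst T (adj-sym G _ _)

Completes-sym : (G : Graph n) → ∀ {u v} → Completes G u v → Completes G v u
Completes-sym G (a , u≢a , va , b , v≢b , ub , ab , a′ , u≢a′ , a≢a′ , va′ , a′b ,
                 b′ , v≢b′ , b≢b′ , ub′ , ab′ , a′b′) =
  b , v≢b , ub , a , u≢a , va , Edge-sym G ab , b′ , v≢b′ , b≢b′ , ub′ , Edge-sym G ab′ ,
  a′ , u≢a′ , a≢a′ , va′ , Edge-sym G a′b , Edge-sym G a′b′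

-- Only `uv` is taken from `H`; the other eight edges come from `G`. With `H` equal to `G` plus `uv`
-- this serves saturation, and with `H` equal to `G` it serves the test for bicliques.
Completes⇒Biclique : (G H : Graph n) → (∀ {i j} → Edge G i j → Edge H i j) →
  ∀ {u v} → Edge H u v → Completes G u v → Biclique H
Completes⇒Biclique {n} G H G⊆H {u} {v} uv
  (a , u≢a , va , b , v≢b , ub , ab , a′ , u≢a′ , a≢a′ , va′ , a′b ,
   b′ , v≢b′ , b≢b′ , ub′ , ab′ , a′b′) = record
  { left            = triple u a a′
  ; right           = triple v b b′
  ; left-injective  = triple-injective u≢a u≢a′ a≢a′
  ; right-injective = triple-injective v≢b v≢b′ b≢b′
  ; cross           = λ where
      0F 0F → uv
      0F 1F → G⊆H ub
      0F 2F → G⊆H ub′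
      1F 0F → G⊆H (Edge-sym G va)
      1F 1F → G⊆H ab
      1F 2F → G⊆H ab′
      2F 0F → G⊆H (Edge-sym G va′)
      2F 1F → G⊆H a′b
      2F 2F → G⊆H a′b′
  }
  where
  triple : Fin n → Fin n → Fin n → Fin 3 → Fin n
  triple p q r 0F = p
  triple p q r 1F = q
  triple p q r 2F = r

  triple-injective : ∀ {p q r} → p ≢ q → p ≢ r → q ≢ r → Injective _≡_ _≡_ (triple p q r)
  triple-injective p≢q p≢r q≢r {0F} {0F} eq = refl
  triple-injective p≢q p≢r q≢r {0F} {1F} eq = ⊥-elim (p≢q eq)
  triple-injective p≢q p≢r q≢r {0F} {2F} eq = ⊥-elim (p≢r eq)
  triple-injective p≢q p≢r q≢r {1F} {0F} eq = ⊥-elim (p≢q (sym eq))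
  triple-injective p≢q p≢r q≢r {1F} {1F} eq = refl
  triple-injective p≢q p≢r q≢r {1F} {2F} eq = ⊥-elim (q≢r eq)
  triple-injective p≢q p≢r q≢r {2F} {0F} eq = ⊥-elim (p≢r (sym eq))
  triple-injective p≢q p≢r q≢r {2F} {1F} eq = ⊥-elim (q≢r (sym eq))
  triple-injective p≢q p≢r q≢r {2F} {2F} eq = refl

Biclique⇒Completes : {G : Graph n} → Biclique G → ∃[ u ] ∃[ v ] Edge G u v × Completes G u v
Biclique⇒Completes {G = G} B =
  left B 0F , right B 0F , cross B 0F 0F ,
  left B 1F , left≢ (λ ()) , Edge-sym G (cross B 1F 0F) ,
  right B 1F , right≢ (λ ()) , cross B 0F 1F , cross B 1F 1F ,
  left B 2F , left≢ (λ ()) , left≢ (λ ()) , Edge-sym G (cross B 2F 0F) , cross B 2F 1F ,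
  right B 2F , right≢ (λ ()) , right≢ (λ ()) , cross B 0F 2F , cross B 1F 2F , cross B 2F 2F
  where
  left≢ : ∀ {i j} → i ≢ j → left B i ≢ left B j
  left≢ i≢j eq = i≢j (left-injective B eq)

  right≢ : ∀ {i j} → i ≢ j → right B i ≢ right B j
  right≢ i≢j eq = i≢j (right-injective B eq)

-- A biclique is an edge together with the eight edges completing it, so the pruned search of
-- `completes?` replaces a search through all maps from six vertices.
biclique? : (G : Graph n) → Dec (Biclique G)
biclique? G =
  map′ (λ (u , v , uv , c) → Completes⇒Biclique G G id uv c) Biclique⇒Completes
    (any? λ u → any? λ v → T? (adj G u v) ×-dec completes? G u v)

-- Saturation phrased inside `G` itself, without forming `addEdge`, so that concrete graphs can be
-- checked by evaluation.
record K₃₃-saturated (G : Graph n) : Set where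
  field
    free      : ¬ Biclique G
    completes : ∀ u v → u ≢ v → ¬ Edge G u v → Completes G u v

open K₃₃-saturated

K₃₃-saturated⇒Saturated : {G : Graph n} → K₃₃-saturated G → Saturated K₃₃ G
K₃₃-saturated⇒Saturated {n} {G} sat = free sat ∘ ⊑⇒Biclique , creates
  where
  T-not : ∀ b → T (not b) → ¬ T b
  T-not false _ ()

  creates : ∀ u v (e : Edge (complement G) u v) →
    K₃₃ ⊑ addEdge G u v (Edge⇒≢ (complement G) e)
  creates u v e = Biclique⇒⊑ (Completes⇒Biclique G G⁺ (Equivalence.from T-∨ ∘ inj₁) uv
    (completes sat u v u≢v (T-not _ (proj₂ (Equivalence.to (T-∧ {not (does (u ≟ v))}) e)))))
    where
    u≢v : u ≢ v
    u≢v = Edge⇒≢ (complement G) e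

    G⁺ : Graph n
    G⁺ = addEdge G u v u≢v

    uv : Edge G⁺ u v
    uv rewrite dec-true (u ≟ u) refl | dec-true (v ≟ v) refl =
      Equivalence.from (T-∨ {adj G u v}) (inj₂ _)

K₃₃-saturated? : (G : Graph n) → Dec (K₃₃-saturated G)
K₃₃-saturated? G =
  map′ (λ (f , c) → record { free = f ; completes = c }) (λ sat → free sat , completes sat)
    (¬? (biclique? G) ×-dec
      all? λ u → all? λ v → ¬? (u ≟ v) →-dec ¬? (T? (adj G u v)) →-dec completes? G u v)

-- The invariant of the triangle extension.

-- Each alternative supplies one of the two K₃₃s of `new-Completes`. Triangle vertices satisfy the
-- first, so the condition survives the extension.
Anchored : Graph n → Fin n → Fin n → Fin n → Set
Anchored G x y s =
  (Edge G s x × Edge G s y) ⊎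
  (∃[ a ] Edge G s a × Edge G x a × Edge G y a ×
  (∃[ b ] a ≢ b × Edge G s b × Edge G x b × Edge G y b))

record Extensible (G : Graph n) (x y : Fin n) : Set where
  field
    saturated : K₃₃-saturated G
    x≢y       : x ≢ y
    anchored  : ∀ s → x ≢ s → y ≢ s → Anchored G x y s

open Extensible

extensible? : (G : Graph n) (x y : Fin n) → Dec (Extensible G x y)
extensible? G x y =
  map′ (λ (s , d , a) → record { saturated = s ; x≢y = d ; anchored = a })
       (λ ext → saturated ext , x≢y ext , anchored ext)
    (K₃₃-saturated? G ×-dec ¬? (x ≟ y) ×-dec
      all? λ s → ¬? (x ≟ s) →-dec ¬? (y ≟ s) →-dec anchored? s)
  where
  edge? : ∀ i j → Dec (Edge G i j)
  edge? i j = T? (adj G i j)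

  anchored? : ∀ s → Dec (Anchored G x y s)
  anchored? s = (edge? s x ×-dec edge? s y) ⊎-dec
    any? λ a → edge? s a ×-dec edge? x a ×-dec edge? y a ×-dec
    any? λ b → ¬? (a ≟ b) ×-dec edge? s b ×-dec edge? x b ×-dec edge? y b

-- Counting by injections.

-- Pigeonhole: sending `i` to the index of its place is injective, since equal places force equal
-- values of `f`.
≤-by-covering : ∀ {A : Set} {m n} {f : Fin m → A} → Injective _≡_ _≡_ f →
  (place : Fin n → A) → (∀ i → ∃[ k ] f i ≡ place k) → m ≤ n
≤-by-covering inj place cover =
  injective⇒≤ {f = proj₁ ∘ cover} λ {i} {j} eq →
    inj (trans (proj₂ (cover i)) (trans (cong place eq) (sym (proj₂ (cover j)))))

some-or-all : ∀ {n} {P Q : Fin n → Set} → (∀ i → P i ⊎ Q i) → ∃ P ⊎ (∀ i → Q i)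
some-or-all {zero} _ = inj₂ λ ()
some-or-all {suc n} h with h zero | some-or-all (h ∘ suc)
... | inj₁ p | _            = inj₁ (zero , p)
... | inj₂ _ | inj₁ (i , p) = inj₁ (suc i , p)
... | inj₂ q | inj₂ qs      = inj₂ λ { zero → q ; (suc i) → qs i }

lookup-injective : ∀ {A : Set} {xs : List A} → Unique xs → Injective _≡_ _≡_ (lookup xs)
lookup-injective (_ ∷ _)     {zero}  {zero}  _  = refl
lookup-injective (x∉ ∷ _)    {zero}  {suc j} eq = ⊥-elim (All.lookup x∉ (∈-lookup j) eq)
lookup-injective (x∉ ∷ _)    {suc i} {zero}  eq = ⊥-elim (All.lookup x∉ (∈-lookup i) (sym eq))
lookup-injective (_ ∷ uniq)  {suc i} {suc j} eq = cong suc (lookup-injective uniq eq)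

-- Distinct positions of `xs` land on distinct positions of `ys`. This bounds an edge count by the
-- length of any list containing the edges.
Unique-⊆⇒length-≤ : ∀ {A : Set} {xs ys : List A} → Unique xs →
  (∀ {z} → z ∈ xs → z ∈ ys) → length xs ≤ length ys
Unique-⊆⇒length-≤ {ys = ys} uniq xs⊆ys =
  ≤-by-covering (lookup-injective uniq) (lookup ys)
    λ i → let z∈ys = xs⊆ys (∈-lookup i) in index z∈ys , lookup-index z∈ys

-- Adding a triangle joined to x and y.

module Triangle (G : Graph n) (x y : Fin n) where

  link : Fin 3 ⊎ Fin n → Fin 3 ⊎ Fin n → Bool
  link (inj₁ i) (inj₁ j) = not (does (i ≟ j))
  link (inj₁ _) (inj₂ v) = does (v ≟ x) ∨ does (v ≟ y)
  link (inj₂ v) (inj₁ _) = does (v ≟ x) ∨ does (v ≟ y)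
  link (inj₂ u) (inj₂ v) = adj G u v

  link-sym : ∀ s t → link s t ≡ link t s
  link-sym (inj₁ i) (inj₁ j) = cong not (does-⇔ (mk⇔ sym sym) (i ≟ j) (j ≟ i))
  link-sym (inj₁ _) (inj₂ _) = refl
  link-sym (inj₂ _) (inj₁ _) = refl
  link-sym (inj₂ u) (inj₂ v) = adj-sym G u v

  link-irrefl : ∀ s → link s s ≡ false
  link-irrefl (inj₁ i) = cong not (dec-true (i ≟ i) refl)
  link-irrefl (inj₂ v) = adj-irrefl G v

  -- New vertices come first, so `splitAt 3 (old v)` computes to `inj₂ v`. Edges between old
  -- vertices are then those of `G` by definition and are passed along unchanged below.
  addTriangle : Graph (3 + n)
  addTriangle = record
    { adj        = λ i j → link (splitAt 3 i) (splitAt 3 j)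
    ; adj-sym    = λ i j → link-sym (splitAt 3 i) (splitAt 3 j)
    ; adj-irrefl = λ i → link-irrefl (splitAt 3 i)
    }

  private
    G⁺ : Graph (3 + n)
    G⁺ = addTriangle

  new : Fin 3 → Fin (3 + n)
  new i = i ↑ˡ n

  old : Fin n → Fin (3 + n)
  old v = 3 ↑ʳ v

  data View : Fin (3 + n) → Set where
    isNew : ∀ i → View (new i)
    isOld : ∀ v → View (old v)

  view : ∀ w → View w
  view 0F                  = isNew 0F
  view 1F                  = isNew 1F
  view 2F                  = isNew 2F
  view (suc (suc (suc v))) = isOld v

  new≢old : ∀ {i v} → new i ≢ old v
  new≢old {0F} ()
  new≢old {1F} ()
  new≢old {2F} ()

  old≢old : ∀ {u v} → u ≢ v → old u ≢ old v
  old≢old u≢v refl = u≢v refl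

  new-adjacent : ∀ {i j} → i ≢ j → Edge G⁺ (new i) (new j)
  new-adjacent {i} {j} i≢j
    rewrite splitAt-↑ˡ 3 i n | splitAt-↑ˡ 3 j n | dec-false (i ≟ j) i≢j = _

  x-adjacent : ∀ i → Edge G⁺ (new i) (old x)
  x-adjacent i rewrite splitAt-↑ˡ 3 i n | dec-true (x ≟ x) refl = _

  y-adjacent : ∀ i → Edge G⁺ (new i) (old y)
  y-adjacent i rewrite splitAt-↑ˡ 3 i n | dec-true (y ≟ y) refl =
    Equivalence.from (T-∨ {does (y ≟ x)}) (inj₂ _)

  adjacent-x : ∀ i → Edge G⁺ (old x) (new i)
  adjacent-x i = Edge-sym G⁺ {new i} {old x} (x-adjacent i)

  adjacent-y : ∀ i → Edge G⁺ (old y) (new i)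
  adjacent-y i = Edge-sym G⁺ {new i} {old y} (y-adjacent i)

  old-neighbour : ∀ i {v} → Edge G⁺ (new i) (old v) → v ≡ x ⊎ v ≡ y
  old-neighbour i {v} e rewrite splitAt-↑ˡ 3 i n with v ≟ x | v ≟ y
  ... | yes v≡x | _       = inj₁ v≡x
  ... | no _    | yes v≡y = inj₂ v≡y
  ... | no _    | no _    = ⊥-elim e

  pole : Fin 2 → Fin (3 + n)
  pole 0F = old x
  pole 1F = old y

  Near : Fin (3 + n) → Set
  Near w = (∃[ i ] w ≡ new i) ⊎ (∃[ p ] w ≡ pole p)

  neighbour-near : ∀ i {w} → Edge G⁺ (new i) w → Near w
  neighbour-near i {w} e with view w
  ... | isNew j = inj₁ (j , refl)
  ... | isOld v with old-neighbour i e
  ...   | inj₁ refl = inj₂ (0F , refl)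
  ...   | inj₂ refl = inj₂ (1F , refl)

  -- Some right vertex is new because x and y cannot account for all three.
  -- Hence the whole biclique lies among the five vertices new i , x , y.
  new∉left : (B : Biclique G⁺) → ∀ i t → left B i ≢ new t
  new∉left B i t eq with some-or-all right-near
    where
    right-near : ∀ j → Near (right B j)
    right-near j = neighbour-near t (subst (λ w → Edge G⁺ w (right B j)) eq (cross B i j))
  ... | inj₂ poles = contradiction (≤-by-covering (right-injective B) pole poles) (ℕ.<⇒≱ ℕ.≤-refl)
  ... | inj₁ (j , t′ , eq′) =
    contradiction
      (≤-by-covering (proj₁ (proj₂ (Biclique⇒⊑ B))) place (placed ∘ near ∘ splitAt 3))
      (ℕ.<⇒≱ ℕ.≤-refl)
    where
    near : ∀ s → Near (vertex B s)
    near (inj₁ i′) = neighbour-near t′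
      (subst (λ w → Edge G⁺ w (left B i′)) eq′ (cross (swap {G = G⁺} B) j i′))
    near (inj₂ j′) = neighbour-near t (subst (λ w → Edge G⁺ w (right B j′)) eq (cross B i j′))

    place : Fin 5 → Fin (3 + n)
    place = [ new , pole ]′ ∘ splitAt 3

    placed : ∀ {w} → Near w → ∃[ k ] w ≡ place k
    placed (inj₁ (i , refl)) = i ↑ˡ 2 , sym (cong [ new , pole ]′ (splitAt-↑ˡ 3 i 2))
    placed (inj₂ (p , refl)) = 3 ↑ʳ p , refl

  -- By `new∉left`, applied to `B` and to its swap, every vertex is old. Freeness thus passes from
  -- `G` to the extension.
  restrict : Biclique G⁺ → Biclique G
  restrict B = record
    { left            = proj₁ ∘ leftOld
    ; right           = proj₁ ∘ rightOld
    ; left-injective  = λ {i} {j} eq → left-injective B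
        (trans (proj₂ (leftOld i)) (trans (cong old eq) (sym (proj₂ (leftOld j)))))
    ; right-injective = λ {i} {j} eq → right-injective B
        (trans (proj₂ (rightOld i)) (trans (cong old eq) (sym (proj₂ (rightOld j)))))
    ; cross           = λ i j →
        subst₂ (Edge G⁺) (proj₂ (leftOld i)) (proj₂ (rightOld j)) (cross B i j)
    }
    where
    isOld′ : ∀ w → (∀ t → w ≢ new t) → ∃[ v ] w ≡ old v
    isOld′ w w≢new with view w
    ... | isNew t = ⊥-elim (w≢new t refl)
    ... | isOld v = v , refl

    leftOld : ∀ i → ∃[ v ] left B i ≡ old v
    leftOld i = isOld′ (left B i) (new∉left B i)

    rightOld : ∀ j → ∃[ v ] right B j ≡ old v
    rightOld j = isOld′ (right B j) (new∉left (swap {G = G⁺} B) j)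

  lift-Completes : ∀ {u v} → Completes G u v → Completes G⁺ (old u) (old v)
  lift-Completes (a , u≢a , va , b , v≢b , ub , ab , a′ , u≢a′ , a≢a′ , va′ , a′b ,
                  b′ , v≢b′ , b≢b′ , ub′ , ab′ , a′b′) =
    old a , old≢old u≢a , va , old b , old≢old v≢b , ub , ab ,
    old a′ , old≢old u≢a′ , old≢old a≢a′ , va′ , a′b ,
    old b′ , old≢old v≢b′ , old≢old b≢b′ , ub′ , ab′ , a′b′

  -- If s is adjacent to x and y, the parts are {new i, x, y} and {s, new j, new j′}, with j and j′
  -- the other two triangle indices. Otherwise they are {new i, a, b} and {s, x, y}.
  new-Completes : Extensible G x y → ∀ i {s} → x ≢ s → y ≢ s → Completes G⁺ (new i) (old s)
  new-Completes ext i {s} x≢s y≢s with anchored ext s x≢s y≢s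
  ... | inj₁ (sx , sy) =
    old x , new≢old , sx ,
    new j , new≢old ∘ sym , new-adjacent i≢j , adjacent-x j ,
    old y , new≢old , old≢old (x≢y ext) , sy , adjacent-y j ,
    new j′ , new≢old ∘ sym , j≢j′ , new-adjacent i≢j′ ,
    adjacent-x j′ , adjacent-y j′
    where
    j j′ : Fin 3
    j  = punchIn i 0F
    j′ = punchIn i 1F

    i≢j : i ≢ j
    i≢j = punchInᵢ≢i i 0F ∘ sym

    i≢j′ : i ≢ j′
    i≢j′ = punchInᵢ≢i i 1F ∘ sym

    j≢j′ : new j ≢ new j′
    j≢j′ eq = contradiction (punchIn-injective i 0F 1F (↑ˡ-injective n j j′ eq)) λ ()
  ... | inj₂ (a , sa , xa , ya , b , a≢b , sb , xb , yb) =
    old a , new≢old , sa ,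
    old x , old≢old (x≢s ∘ sym) , x-adjacent i , Edge-sym G xa ,
    old b , new≢old , old≢old a≢b , sb , Edge-sym G xb ,
    old y , old≢old (y≢s ∘ sym) , old≢old (x≢y ext) , y-adjacent i , Edge-sym G ya , Edge-sym G yb

  addTriangle-completes : Extensible G x y →
    ∀ u v → u ≢ v → ¬ Edge G⁺ u v → Completes G⁺ u v
  addTriangle-completes ext u v u≢v ¬uv with view u | view v
  ... | isNew i | isNew j = ⊥-elim (¬uv (new-adjacent (u≢v ∘ cong new)))
  ... | isNew i | isOld s = new-Completes ext i
          (λ { refl → ¬uv (x-adjacent i) }) (λ { refl → ¬uv (y-adjacent i) })
  ... | isOld s | isNew i = Completes-sym G⁺ (new-Completes ext i
          (λ { refl → ¬uv (adjacent-x i) })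
          (λ { refl → ¬uv (adjacent-y i) }))
  ... | isOld u′ | isOld v′ =
          lift-Completes (completes (saturated ext) u′ v′ (u≢v ∘ cong old) ¬uv)

  addTriangle-anchored : Extensible G x y →
    ∀ s → old x ≢ s → old y ≢ s → Anchored G⁺ (old x) (old y) s
  addTriangle-anchored ext s x≢s y≢s with view s
  ... | isNew i = inj₁ (x-adjacent i , y-adjacent i)
  ... | isOld v with anchored ext v (x≢s ∘ cong old) (y≢s ∘ cong old)
  ...   | inj₁ sxy = inj₁ sxy
  ...   | inj₂ (a , sa , xa , ya , b , a≢b , sb , xb , yb) =
            inj₂ (old a , sa , xa , ya , old b , old≢old a≢b , sb , xb , yb)

  addTriangle-extensible : Extensible G x y → Extensible G⁺ (old x) (old y)
  addTriangle-extensible ext = record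
    { saturated = record
        { free      = free (saturated ext) ∘ restrict
        ; completes = addTriangle-completes ext
        }
    ; x≢y      = old≢old (x≢y ext)
    ; anchored = addTriangle-anchored ext
    }

  -- Three edges of the triangle, six from it to x and y, then those of `G`. For an upper bound on
  -- the size, the inclusion `edges-⊆` suffices.
  addTriangle-edges : List (Fin (3 + n) × Fin (3 + n))
  addTriangle-edges =
    (new 0F , new 1F) ∷ (new 0F , new 2F) ∷ (new 1F , new 2F) ∷
    cartesianProduct (map new (allFin 3)) (old x ∷ old y ∷ []) ++
    map (λ (u , v) → old u , old v) (edges G)

  edges-⊆ : ∀ {e} → e ∈ edges G⁺ → e ∈ addTriangle-edges
  edges-⊆ {i , j} e∈
    with (_ , i<j , e) ← ∈-filter⁻ (λ (i , j) → (i <? j) ×-dec T? (adj G⁺ i j))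
           {xs = cartesianProduct (allFin (3 + n)) (allFin (3 + n))} e∈ = go (view i) (view j) i<j e
    where
    between : ∀ a {v} → v ∈ old x ∷ old y ∷ [] → (new a , v) ∈ addTriangle-edges
    between a v∈ = there (there (there (∈-++⁺ˡ
      (∈-cartesianProduct⁺ (∈-map⁺ new (∈-allFin a)) v∈))))

    go : ∀ {i j} → View i → View j → toℕ i < toℕ j → Edge G⁺ i j → (i , j) ∈ addTriangle-edges
    go (isNew 0F) (isNew 1F) _ _ = here refl
    go (isNew 0F) (isNew 2F) _ _ = there (here refl)
    go (isNew 1F) (isNew 2F) _ _ = there (there (here refl))
    -- Repeated and reversed pairs contradict `i < j`.
    go (isNew 1F) (isNew 1F) (s≤s ()) _
    go (isNew 2F) (isNew 1F) (s≤s ()) _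
    go (isNew 2F) (isNew 2F) (s≤s (s≤s ())) _
    go (isNew a) (isOld v) _ e with old-neighbour a e
    ... | inj₁ refl = between a (here refl)
    ... | inj₂ refl = between a (there (here refl))
    go (isOld v) (isNew 1F) (s≤s ()) _
    go (isOld v) (isNew 2F) (s≤s (s≤s ())) _
    go (isOld u) (isOld v) (s≤s (s≤s (s≤s u<v))) e =
      there (there (there (∈-++⁺ʳ _ (∈-map⁺ _
        (∈-filter⁺ _ (∈-cartesianProduct⁺ (∈-allFin u) (∈-allFin v)) (u<v , e))))))

  size-addTriangle : size G⁺ ≤ 9 + size G
  size-addTriangle = ℕ.≤-trans
    (Unique-⊆⇒length-≤ (filter⁺ (λ (i , j) → (i <? j) ×-dec T? (adj G⁺ i j))
      (cartesianProduct⁺ (allFin⁺ _) (allFin⁺ _))) edges-⊆)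
    -- The first nine entries of the list are counted by computation.
    (ℕ.≤-reflexive (cong (9 +_) (length-map _ (edges G))))

-- Explicit graphs of small order.

listed : Vec (List ℕ) n → Matrix n
listed rows i j = does (toℕ j ∈? Vec.lookup rows i)

-- The implicit arguments are solved by evaluation, so type checking each table verifies that it is
-- symmetric and loopless.
fromNeighbours : (rows : Vec (List ℕ) n) →
  {True (all? λ i → all? λ j → listed rows i j Bool.≟ listed rows j i)} →
  {True (all? λ i → listed rows i i Bool.≟ false)} → Graph n
fromNeighbours rows {A-sym} {A-irr} =
  record { adj = listed rows ; adj-sym = toWitness A-sym ; adj-irrefl = toWitness A-irr }

-- The octahedron; the five graphs after it were found by a computer search.
G₆ : Graph 6
G₆ = fromNeighbours
  ((1 ∷ 2 ∷ 4 ∷ 5 ∷ [])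
  ∷ (0 ∷ 2 ∷ 3 ∷ 5 ∷ [])
  ∷ (0 ∷ 1 ∷ 3 ∷ 4 ∷ [])
  ∷ (1 ∷ 2 ∷ 4 ∷ 5 ∷ [])
  ∷ (0 ∷ 2 ∷ 3 ∷ 5 ∷ [])
  ∷ (0 ∷ 1 ∷ 3 ∷ 4 ∷ [])
  ∷ [])

-- A K₃₃ on six vertices requires the complement to lie in two disjoint triangles. The complement
-- here is three disjoint edges, which do not fit; any two of them do.
G₆-saturated : K₃₃-saturated G₆
G₆-saturated = from-yes (K₃₃-saturated? G₆)

-- The complete graph on 0, 3, 4, 5, 6, with 1 joined to 0, 3 and 2 joined to 4, 6. Vertices of
-- degree two lie in no K₃₃.
G₇ : Graph 7
G₇ = fromNeighbours
  ((1 ∷ 3 ∷ 4 ∷ 5 ∷ 6 ∷ [])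
  ∷ (0 ∷ 3 ∷ [])
  ∷ (4 ∷ 6 ∷ [])
  ∷ (0 ∷ 1 ∷ 4 ∷ 5 ∷ 6 ∷ [])
  ∷ (0 ∷ 2 ∷ 3 ∷ 5 ∷ 6 ∷ [])
  ∷ (0 ∷ 3 ∷ 4 ∷ 6 ∷ [])
  ∷ (0 ∷ 2 ∷ 3 ∷ 4 ∷ 5 ∷ [])
  ∷ [])

G₇-saturated : K₃₃-saturated G₇
G₇-saturated = from-yes (K₃₃-saturated? G₇)

-- The octahedron with antipodal pairs {0, 5}, {1, 6}, {2, 3}, where 4 is joined to the first pair
-- and 7 to the second.
G₈ : Graph 8
G₈ = fromNeighbours
  ((1 ∷ 2 ∷ 3 ∷ 4 ∷ 6 ∷ [])
  ∷ (0 ∷ 2 ∷ 3 ∷ 5 ∷ 7 ∷ [])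
  ∷ (0 ∷ 1 ∷ 5 ∷ 6 ∷ [])
  ∷ (0 ∷ 1 ∷ 5 ∷ 6 ∷ [])
  ∷ (0 ∷ 5 ∷ [])
  ∷ (1 ∷ 2 ∷ 3 ∷ 4 ∷ 6 ∷ [])
  ∷ (0 ∷ 2 ∷ 3 ∷ 5 ∷ 7 ∷ [])
  ∷ (1 ∷ 6 ∷ [])
  ∷ [])

G₈-saturated : K₃₃-saturated G₈
G₈-saturated = from-yes (K₃₃-saturated? G₈)

-- The octahedron with antipodal pairs {0, 1}, {3, 6}, {7, 8}, to which 4, 5 and 2 respectively are
-- joined.
G₉ : Graph 9
G₉ = fromNeighbours
  ((3 ∷ 4 ∷ 6 ∷ 7 ∷ 8 ∷ [])
  ∷ (3 ∷ 4 ∷ 6 ∷ 7 ∷ 8 ∷ [])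
  ∷ (7 ∷ 8 ∷ [])
  ∷ (0 ∷ 1 ∷ 5 ∷ 7 ∷ 8 ∷ [])
  ∷ (0 ∷ 1 ∷ [])
  ∷ (3 ∷ 6 ∷ [])
  ∷ (0 ∷ 1 ∷ 5 ∷ 7 ∷ 8 ∷ [])
  ∷ (0 ∷ 1 ∷ 2 ∷ 3 ∷ 6 ∷ [])
  ∷ (0 ∷ 1 ∷ 2 ∷ 3 ∷ 6 ∷ [])
  ∷ [])

-- The vertices 5 and 2 are anchored through {3, 6} and {7, 8}; all others are adjacent to both 0
-- and 1.
G₉-extensible : Extensible G₉ 0F 1F
G₉-extensible = from-yes (extensible? G₉ 0F 1F)

-- A relabelled `G₉`, with antipodal pairs {0, 1}, {2, 7}, {3, 4}, plus the vertex 8 joined to the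
-- face 1, 2, 3.
G₁₀ : Graph 10
G₁₀ = fromNeighbours
  ((2 ∷ 3 ∷ 4 ∷ 7 ∷ 9 ∷ [])
  ∷ (2 ∷ 3 ∷ 4 ∷ 7 ∷ 8 ∷ 9 ∷ [])
  ∷ (0 ∷ 1 ∷ 3 ∷ 4 ∷ 6 ∷ 8 ∷ [])
  ∷ (0 ∷ 1 ∷ 2 ∷ 5 ∷ 7 ∷ 8 ∷ [])
  ∷ (0 ∷ 1 ∷ 2 ∷ 5 ∷ 7 ∷ [])
  ∷ (3 ∷ 4 ∷ [])
  ∷ (2 ∷ 7 ∷ [])
  ∷ (0 ∷ 1 ∷ 3 ∷ 4 ∷ 6 ∷ [])
  ∷ (1 ∷ 2 ∷ 3 ∷ [])
  ∷ (0 ∷ 1 ∷ [])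
  ∷ [])

G₁₀-extensible : Extensible G₁₀ 0F 1F
G₁₀-extensible = from-yes (extensible? G₁₀ 0F 1F)

-- Like `G₁₀`, but with two adjacent vertices, 2 and 4, joined to the pair {0, 1} instead of one.
-- The other pairs are {6, 8}, {9, 10}, and 7 is joined to the face 1, 6, 10.
G₁₁ : Graph 11
G₁₁ = fromNeighbours
  ((2 ∷ 4 ∷ 6 ∷ 8 ∷ 9 ∷ 10 ∷ [])
  ∷ (2 ∷ 4 ∷ 6 ∷ 7 ∷ 8 ∷ 9 ∷ 10 ∷ [])
  ∷ (0 ∷ 1 ∷ 4 ∷ [])
  ∷ (6 ∷ 8 ∷ [])
  ∷ (0 ∷ 1 ∷ 2 ∷ [])
  ∷ (9 ∷ 10 ∷ [])
  ∷ (0 ∷ 1 ∷ 3 ∷ 7 ∷ 9 ∷ 10 ∷ [])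
  ∷ (1 ∷ 6 ∷ 10 ∷ [])
  ∷ (0 ∷ 1 ∷ 3 ∷ 9 ∷ 10 ∷ [])
  ∷ (0 ∷ 1 ∷ 5 ∷ 6 ∷ 8 ∷ [])
  ∷ (0 ∷ 1 ∷ 5 ∷ 6 ∷ 7 ∷ 8 ∷ [])
  ∷ [])

G₁₁-extensible : Extensible G₁₁ 0F 1F
G₁₁-extensible = from-yes (extensible? G₁₁ 0F 1F)

-- Assembly for all orders.

-- For n = 9 + k the bound `18 + 3 * k` is 3n - 9; each triangle raises k by three and the bound by
-- nine.
extensibleGraph : ∀ k → Σ (Graph (9 + k)) λ G →
  (∃[ x ] ∃[ y ] Extensible G x y) × size G ≤ 18 + 3 * k
extensibleGraph 0 = G₉ , (0F , 1F , G₉-extensible) , from-yes (size G₉ ℕ.≤? 18)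
extensibleGraph 1 = G₁₀ , (0F , 1F , G₁₀-extensible) , from-yes (size G₁₀ ℕ.≤? 21)
extensibleGraph 2 = G₁₁ , (0F , 1F , G₁₁-extensible) , from-yes (size G₁₁ ℕ.≤? 24)
extensibleGraph (suc (suc (suc k))) with extensibleGraph k
... | G , (x , y , ext) , size≤ =
  addTriangle , (old x , old y , addTriangle-extensible ext) , (begin
    size addTriangle    ≤⟨ size-addTriangle ⟩
    9 + size G          ≤⟨ ℕ.+-monoʳ-≤ 9 size≤ ⟩
    9 + (18 + 3 * k)    ≡⟨ cong (18 +_) (ℕ.*-distribˡ-+ 3 3 k) ⟨
    18 + 3 * (3 + k)    ∎)
  where
  open Triangle G x y
  open ℕ.≤-Reasoning

saturatedGraph : ∀ k → let n = 6 + k in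
  Σ (Graph n) λ G → K₃₃-saturated G × (n ≤ 8 → size G ≤ 2 * n) × (9 ≤ n → size G ≤ 3 * n ∸ 9)
saturatedGraph 0 = G₆ , G₆-saturated , (λ _ → from-yes (size G₆ ℕ.≤? 12)) ,
  λ 9≤6 → contradiction 9≤6 (ℕ.m+n≮m 6 2)
saturatedGraph 1 = G₇ , G₇-saturated , (λ _ → from-yes (size G₇ ℕ.≤? 14)) ,
  λ 9≤7 → contradiction 9≤7 (ℕ.m+n≮m 7 1)
saturatedGraph 2 = G₈ , G₈-saturated , (λ _ → from-yes (size G₈ ℕ.≤? 16)) ,
  λ 9≤8 → contradiction 9≤8 (ℕ.m+n≮m 8 0)
saturatedGraph (suc (suc (suc k))) with extensibleGraph k
... | G , (_ , _ , ext) , size≤ = G , saturated ext ,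
  (λ n≤8 → contradiction (s≤s n≤8) (ℕ.m+n≮m 9 k)) ,
  -- After distributing, `3 * 9 + 3 * k ∸ 9` computes to `18 + 3 * k`.
  λ _ → ℕ.≤-trans size≤ (ℕ.≤-reflexive (cong (_∸ 9) (sym (ℕ.*-distribˡ-+ 3 9 k))))

theorem1p2 : ∀ (n : ℕ) → 6 ≤ n →
    ∃[ s ] (IsSaturationNumber n (completeBipartite 3 3) s
    × (n ≤ 8 → s ≤ 2 * n)
    × (9 ≤ n → s ≤ 3 * n ∸ 9))
theorem1p2 n 6≤n with k , refl ← ℕ.m≤n⇒∃[o]m+o≡n 6≤n =
  let G , sat , ≤2n , ≤3n∸9 = saturatedGraph k
      s , isSat , s≤ = saturationNumber≤ K₃₃ G (K₃₃-saturated⇒Saturated sat)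
  in s , isSat , ℕ.≤-trans s≤ ∘ ≤2n , ℕ.≤-trans s≤ ∘ ≤3n∸9
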